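{- Let $\mathbb{F}_q$ be a finite field of odd characteristic, let $a,d\in\mathbb{F}_q$ with $ad(a-d)\neq 0$, and let $w(x,y)=dx^2y^2$ on the twisted Edwards curve $E_{a,d}: ax^2+y^2=1+dx^2y^2$. Let $P_1,P_2$ be affine points of $E_{a,d}(\mathbb{F}_q)$ and put $w_0=w(P_2-P_1)$, $w_1=w(P_1)$, $w_2=w(P_2)$, $w_3=w(P_1+P_2)$, $w_4=w(2P_1)$. If $w_1w_2\neq 1$ and $w_1^2\neq 1$, then $$w_4=\frac{4w_1\left((w_1+1)^2-ew_1\right)}{(w_1^2-1)^2},\qquad w_3w_0=\frac{(w_1-w_2)^2}{(w_1w_2-1)^2},$$ and $$w_3+w_0=\frac{2(w_1+w_2)(w_1w_2+1)-4(e-2)w_1w_2}{(w_1w_2-1)^2},$$ where $e=4a/d$.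
   Context: The nonsingular model of $E_{a,d}$ is the curve in $\mathbb{P}^3$ of points $(X:Y:T:Z)$ with $aX^2+Y^2=Z^2+dT^2$ and $XY=ZT$; an affine point $(x,y)$ corresponds to $(x:y:xy:1)$. $E_{a,d}(\mathbb{F}_q)$ is the group of $\mathbb{F}_q$-rational points of this model, with neutral element $\mathcal{O}=(0,1)$, $-(x,y)=(-x,y)$, and (elliptic curve) group law given on affine points, whenever the denominators are nonzero, by $(x_1,y_1)+(x_2,y_2)=\left(\frac{x_1y_2+x_2y_1}{1+dx_1x_2y_1y_2},\frac{y_1y_2-ax_1x_2}{1-dx_1x_2y_1y_2}\right)$. The function $w$ takes finite values exactly at the affine points. -}

module Defs where

open import Algebra.Bundles using (CommutativeRing; RawRing)
import Algebra.Properties.AbelianGroup as AbelianGroupProperties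
import Algebra.Properties.Group as GroupProperties
import Algebra.Properties.Monoid.Mult.TCOptimised as Mult
import Algebra.Properties.Ring as RingProperties
import Algebra.Properties.Semiring.Exp.TCOptimised as Exp
import Algebra.Properties.Semiring.Mult.TCOptimised as SemiringMult
import Algebra.Solver.Ring as RingSolver
open import Algebra.Solver.Ring.AlmostCommutativeRing using (_-Raw-AlmostCommutative⟶_; fromCommutativeRing)
open import Data.Empty using (⊥; ⊥-elim)
open import Data.Fin using (Fin)
import Data.Fin.Properties as Fin
open import Data.Integer as ℤ using (ℤ; +_; -[1+_]; _⊖_)
import Data.Integer.Properties as ℤ
open import Data.Maybe using (Maybe; just; nothing)
open import Data.Maybe.Relation.Binary.Pointwise using (Pointwise)
open import Data.Nat as ℕ using (ℕ; zero; suc; s≤s)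
open import Data.Nat.Divisibility using (_∣_; ∣⇒≤; ∣-refl; _∣0)
open import Data.Product using (∃; _×_; _,_; proj₁; proj₂)
open import Data.Sum using (_⊎_; inj₁; inj₂)
open import Function.Bundles using (Inverse; _⇔_; Equivalence)
open import Level using (_⊔_) renaming (suc to lsuc)
open import Relation.Binary.Definitions using (Decidable; WeaklyDecidable)
import Relation.Binary.PropositionalEquality as ≡
open import Relation.Nullary using (¬_; Dec; yes; no)
open import Relation.Nullary.Decidable using (_×-dec_; ¬?; map′)
import Relation.Binary.Reasoning.Setoid as ≈-Reasoning

-- Ring identities are solved with coefficients in ℤ, so that cancellation
-- is visible to the normaliser over an arbitrary commutative ring.
module IntegerSolver {c ℓ} (R : CommutativeRing c ℓ) where
  open CommutativeRing R
  open RingProperties ring using (-‿distribˡ-*; -‿distribʳ-*)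
  open GroupProperties +-group using (ε⁻¹≈ε; ⁻¹-involutive)
  open AbelianGroupProperties +-abelianGroup using (⁻¹-∙-comm)
  open SemiringMult semiring renaming (_×_ to _·_)
  open ≈-Reasoning setoid

  private
    ⟦_⟧ : ℤ → Carrier
    ⟦ + n ⟧      = n · 1#
    ⟦ -[1+ n ] ⟧ = - (suc n · 1#)

    cancel : ∀ x y z → (x + y) - (x + z) ≈ y - z
    cancel x y z = begin
      (x + y) - (x + z)       ≈⟨ +-congˡ (⁻¹-∙-comm x z) ⟨
      (x + y) + (- x - z)     ≈⟨ +-congʳ (+-comm x y) ⟩
      (y + x) + (- x - z)     ≈⟨ +-assoc y x _ ⟩
      y + (x + (- x - z))     ≈⟨ +-congˡ (+-assoc x _ _) ⟨
      y + ((x - x) - z)       ≈⟨ +-congˡ (+-congʳ (-‿inverseʳ x)) ⟩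
      y + (0# - z)            ≈⟨ +-congˡ (+-identityˡ _) ⟩
      y - z                   ∎

    neg-homo : ∀ i → ⟦ ℤ.- i ⟧ ≈ - ⟦ i ⟧
    neg-homo (+ zero)   = sym ε⁻¹≈ε
    neg-homo (+ suc n)  = refl
    neg-homo (-[1+ n ]) = sym (⁻¹-involutive _)

    ⊖-homo : ∀ m n → ⟦ m ⊖ n ⟧ ≈ m · 1# - n · 1#
    ⊖-homo m zero = begin
      m · 1#       ≈⟨ +-identityʳ _ ⟨
      m · 1# + 0#  ≈⟨ +-congˡ ε⁻¹≈ε ⟨
      m · 1# - 0#  ∎
    ⊖-homo zero (suc n) = sym (+-identityˡ _)
    ⊖-homo (suc m) (suc n) = begin
      ⟦ suc m ⊖ suc n ⟧              ≡⟨ ≡.cong ⟦_⟧ (ℤ.[1+m]⊖[1+n]≡m⊖n m n) ⟩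
      ⟦ m ⊖ n ⟧                      ≈⟨ ⊖-homo m n ⟩
      m · 1# - n · 1#                ≈⟨ cancel 1# _ _ ⟨
      (1# + m · 1#) - (1# + n · 1#)  ≈⟨ +-cong (1+× m 1#) (-‿cong (1+× n 1#)) ⟨
      suc m · 1# - suc n · 1#        ∎

    +-homo : ∀ i j → ⟦ i ℤ.+ j ⟧ ≈ ⟦ i ⟧ + ⟦ j ⟧
    +-homo (+ m)      (+ n)      = ×-homo-+ 1# m n
    +-homo (+ m)      (-[1+ n ]) = ⊖-homo m (suc n)
    +-homo (-[1+ m ]) (+ n)      = trans (⊖-homo n (suc m)) (+-comm _ _)
    +-homo (-[1+ m ]) (-[1+ n ]) = begin
      - (suc (suc (m ℕ.+ n)) · 1#)   ≡⟨ ≡.cong (λ k → - (suc k · 1#)) (+-suc m n) ⟨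
      - ((suc m ℕ.+ suc n) · 1#)     ≈⟨ -‿cong (×-homo-+ 1# (suc m) (suc n)) ⟩
      - (suc m · 1# + suc n · 1#)    ≈⟨ ⁻¹-∙-comm _ _ ⟨
      - (suc m · 1#) - suc n · 1#    ∎
      where open import Data.Nat.Properties using (+-suc)

    *-homo : ∀ i j → ⟦ i ℤ.* j ⟧ ≈ ⟦ i ⟧ * ⟦ j ⟧
    *-homo (+ m) (+ n) =
      trans (reflexive (≡.cong ⟦_⟧ (ℤ.+◃n≡+n (m ℕ.* n)))) (×1-homo-* m n)
    *-homo (+ m) (-[1+ n ]) = begin
      ⟦ + m ℤ.* -[1+ n ] ⟧      ≡⟨ ≡.cong ⟦_⟧ (ℤ.-◃n≡-n (m ℕ.* suc n)) ⟩
      ⟦ ℤ.- + (m ℕ.* suc n) ⟧   ≈⟨ neg-homo (+ (m ℕ.* suc n)) ⟩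
      - ((m ℕ.* suc n) · 1#)    ≈⟨ -‿cong (×1-homo-* m (suc n)) ⟩
      - (m · 1# * suc n · 1#)   ≈⟨ -‿distribʳ-* _ _ ⟩
      m · 1# * - (suc n · 1#)   ∎
    *-homo (-[1+ m ]) (+ n) = begin
      ⟦ -[1+ m ] ℤ.* + n ⟧      ≡⟨ ≡.cong ⟦_⟧ (ℤ.-◃n≡-n (suc m ℕ.* n)) ⟩
      ⟦ ℤ.- + (suc m ℕ.* n) ⟧   ≈⟨ neg-homo (+ (suc m ℕ.* n)) ⟩
      - ((suc m ℕ.* n) · 1#)    ≈⟨ -‿cong (×1-homo-* (suc m) n) ⟩
      - (suc m · 1# * n · 1#)   ≈⟨ -‿distribˡ-* _ _ ⟩
      - (suc m · 1#) * n · 1#   ∎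
    *-homo (-[1+ m ]) (-[1+ n ]) = begin
      (suc m ℕ.* suc n) · 1#            ≈⟨ ×1-homo-* (suc m) (suc n) ⟩
      suc m · 1# * suc n · 1#           ≈⟨ ⁻¹-involutive _ ⟨
      - - (suc m · 1# * suc n · 1#)     ≈⟨ -‿cong (-‿distribˡ-* _ _) ⟩
      - (- (suc m · 1#) * suc n · 1#)   ≈⟨ -‿distribʳ-* _ _ ⟩
      - (suc m · 1#) * - (suc n · 1#)   ∎

    morphism : ℤ.+-*-rawRing -Raw-AlmostCommutative⟶ fromCommutativeRing R
    morphism = record
      { ⟦_⟧    = ⟦_⟧
      ; +-homo = +-homo
      ; *-homo = *-homo
      ; -‿homo = neg-homo
      ; 0-homo = refl
      ; 1-homo = refl
      }

    _coeff≟_ : WeaklyDecidable (λ i j → ⟦ i ⟧ ≈ ⟦ j ⟧)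
    i coeff≟ j with i ℤ.≟ j
    ... | yes i≡j = just (reflexive (≡.cong ⟦_⟧ i≡j))
    ... | no  _   = nothing

  open RingSolver ℤ.+-*-rawRing (fromCommutativeRing R) morphism _coeff≟_ public
    using (con; solve; _:=_; _:+_; _:*_; _:-_; :-_)

record FiniteField c ℓ : Set (lsuc (c ⊔ ℓ)) where
  field
    commutativeRing : CommutativeRing c ℓ
  open CommutativeRing commutativeRing public
  field
    1≉0        : 1# ≉ 0#
    invertible : ∀ {x} → x ≉ 0# → ∃ λ y → x * y ≈ 1#
    finite     : ∃ λ q → Inverse setoid (≡.setoid (Fin q))

  open Mult +-monoid public using () renaming (_×_ to infixr 8 _·_)
  open Exp semiring public using (_^_)
  open IntegerSolver commutativeRing public

  HasCharacteristic : ℕ → Set ℓ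
  HasCharacteristic p = ∀ n → n · 1# ≈ 0# ⇔ p ∣ n

  OddCharacteristic : Set ℓ
  OddCharacteristic = ∃ λ p → HasCharacteristic p × ¬ 2 ∣ p

  infix 4 _≟_
  _≟_ : Decidable _≈_
  x ≟ y = map′ injective to-cong (to x Fin.≟ to y)
    where
    open Inverse (proj₂ finite)
    injective : to x ≡.≡ to y → x ≈ y
    injective eq = trans (sym (inverseʳ ≡.refl)) (inverseʳ eq)

  -- Totalised by 0 ⁻¹ = 0.
  infix 9 _⁻¹
  _⁻¹ : Carrier → Carrier
  x ⁻¹ with x ≟ 0#
  ... | yes _   = 0#
  ... | no  x≉0 = proj₁ (invertible x≉0)

  infixl 7 _/_
  _/_ : Carrier → Carrier → Carrier
  x / y = x * y ⁻¹

module FieldProperties {c ℓ} (F : FiniteField c ℓ) where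
  open FiniteField F
  open ≈-Reasoning setoid

  infixr 7 _⊗_
  _⊗_ : ∀ c {x} → x ≈ 0# → c * x ≈ 0#
  c ⊗ x≈0 = trans (*-congˡ x≈0) (zeroʳ c)

  infixl 6 _⊞_
  _⊞_ : ∀ {x y} → x ≈ 0# → y ≈ 0# → x + y ≈ 0#
  x≈0 ⊞ y≈0 = trans (+-cong x≈0 y≈0) (+-identityˡ 0#)

  x≈y⇒x-y≈0 : ∀ {x y} → x ≈ y → x - y ≈ 0#
  x≈y⇒x-y≈0 = GroupProperties.x≈y⇒x∙y⁻¹≈ε +-group

  x-y≈0⇒x≈y : ∀ {x y} → x - y ≈ 0# → x ≈ y
  x-y≈0⇒x≈y = GroupProperties.x∙y⁻¹≈ε⇒x≈y +-group _ _

  zero-product : ∀ {x y} → x * y ≈ 0# → x ≈ 0# ⊎ y ≈ 0#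
  zero-product {x} {y} xy≈0 with x ≟ 0#
  ... | yes x≈0 = inj₁ x≈0
  ... | no  x≉0 with x⁻¹ , x*x⁻¹≈1 ← invertible x≉0 = inj₂ (begin
    y              ≈⟨ *-identityˡ y ⟨
    1# * y         ≈⟨ *-congʳ x*x⁻¹≈1 ⟨
    x * x⁻¹ * y    ≈⟨ solve 3 (λ x i y → x :* i :* y := i :* (x :* y)) refl x x⁻¹ y ⟩
    x⁻¹ * (x * y)  ≈⟨ x⁻¹ ⊗ xy≈0 ⟩
    0#             ∎)

  cancel-≉0 : ∀ {x y} → x ≉ 0# → x * y ≈ 0# → y ≈ 0#
  cancel-≉0 x≉0 xy≈0 with zero-product xy≈0
  ... | inj₁ x≈0 = ⊥-elim (x≉0 x≈0)
  ... | inj₂ y≈0 = y≈0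

  square≈0 : ∀ {x} → x * x ≈ 0# → x ≈ 0#
  square≈0 xx≈0 with zero-product xx≈0
  ... | inj₁ x≈0 = x≈0
  ... | inj₂ x≈0 = x≈0

  *-≉0 : ∀ {x y} → x ≉ 0# → y ≉ 0# → x * y ≉ 0#
  *-≉0 x≉0 y≉0 xy≈0 = y≉0 (cancel-≉0 x≉0 xy≈0)

  ⁻¹-inverseʳ : ∀ {x} → x ≉ 0# → x * x ⁻¹ ≈ 1#
  ⁻¹-inverseʳ {x} x≉0 with x ≟ 0#
  ... | yes x≈0  = ⊥-elim (x≉0 x≈0)
  ... | no  x≉0′ = proj₂ (invertible x≉0′)

  /-cross : ∀ {p q r s} → q ≉ 0# → s ≉ 0# → p * s ≈ r * q → p / q ≈ r / s
  /-cross {p} {q} {r} {s} q≉0 s≉0 ps≈rq = begin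
    p * q ⁻¹                    ≈⟨ *-identityʳ _ ⟨
    p * q ⁻¹ * 1#               ≈⟨ *-congˡ (⁻¹-inverseʳ s≉0) ⟨
    p * q ⁻¹ * (s * s ⁻¹)       ≈⟨ swap p (q ⁻¹) s (s ⁻¹) ⟩
    p * s * (q ⁻¹ * s ⁻¹)       ≈⟨ *-congʳ ps≈rq ⟩
    r * q * (q ⁻¹ * s ⁻¹)       ≈⟨ solve 4 (λ r q i j → r :* q :* (i :* j) := r :* j :* (q :* i))
                                     refl r q (q ⁻¹) (s ⁻¹) ⟩
    r * s ⁻¹ * (q * q ⁻¹)       ≈⟨ *-congˡ (⁻¹-inverseʳ q≉0) ⟩
    r * s ⁻¹ * 1#               ≈⟨ *-identityʳ _ ⟩
    r * s ⁻¹                    ∎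
    where
    swap : ∀ p i s j → p * i * (s * j) ≈ p * s * (i * j)
    swap = solve 4 (λ p i s j → p :* i :* (s :* j) := p :* s :* (i :* j)) refl

NonDegenerate : ∀ {c ℓ} (F : FiniteField c ℓ) (a d : FiniteField.Carrier F) → Set ℓ
NonDegenerate F a d = a * d * (a - d) ≉ 0#
  where open FiniteField F

module TwistedEdwards
  {c ℓ} (F : FiniteField c ℓ) (odd : FiniteField.OddCharacteristic F)
  (a d : FiniteField.Carrier F) (ad[a-d]≉0 : NonDegenerate F a d)
  where

  open FiniteField F
  open FieldProperties F
  open ≈-Reasoning setoid

  record AffinePoint : Set (c ⊔ ℓ) where
    field
      x y     : Carrier
      onCurve : a * x ^ 2 + y ^ 2 ≈ 1# + d * x ^ 2 * y ^ 2

  record Coordinates : Set c where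
    constructor ⟨_∶_∶_∶_⟩
    field
      X Y T Z : Carrier

  NonZero : Coordinates → Set ℓ
  NonZero ⟨ X ∶ Y ∶ T ∶ Z ⟩ = ¬ (X ≈ 0# × Y ≈ 0# × T ≈ 0# × Z ≈ 0#)

  OnModel : Coordinates → Set ℓ
  OnModel ⟨ X ∶ Y ∶ T ∶ Z ⟩ =
    a * X ^ 2 + Y ^ 2 ≈ Z ^ 2 + d * T ^ 2 × X * Y ≈ Z * T

  record Point : Set (c ⊔ ℓ) where
    constructor point
    field
      coordinates : Coordinates
      nonZero     : NonZero coordinates
      onModel     : OnModel coordinates
    open Coordinates coordinates public

  -- A Point is a choice of homogeneous coordinates; _≈ₚ_ is equality in ℙ³.
  infix 4 _≈ₚ_
  _≈ₚ_ : Point → Point → Set (c ⊔ ℓ)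
  P ≈ₚ Q = ∃ λ k → k ≉ 0# × X P ≈ k * X Q × Y P ≈ k * Y Q × T P ≈ k * T Q × Z P ≈ k * Z Q
    where open Point

  abstract
    ι-onModel : ∀ {x y} → a * x ^ 2 + y ^ 2 ≈ 1# + d * x ^ 2 * y ^ 2 →
                OnModel ⟨ x ∶ y ∶ x * y ∶ 1# ⟩
    ι-onModel {x} {y} onCurve =
      trans onCurve
        (solve 3 (λ d x y → con (+ 1) :+ d :* (x :* x) :* (y :* y)
                         := con (+ 1) :* con (+ 1) :+ d :* ((x :* y) :* (x :* y)))
                 refl d x y)
      , sym (*-identityˡ (x * y))

    -‿nonZero : ∀ {X Y T Z} → NonZero ⟨ X ∶ Y ∶ T ∶ Z ⟩ → NonZero ⟨ - X ∶ Y ∶ - T ∶ Z ⟩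
    -‿nonZero nonZero (-X≈0 , Y≈0 , -T≈0 , Z≈0) = nonZero (-x≈0 -X≈0 , Y≈0 , -x≈0 -T≈0 , Z≈0)
      where
      -x≈0 : ∀ {x} → - x ≈ 0# → x ≈ 0#
      -x≈0 {x} -x≈0 = trans (solve 1 (λ x → x := :- con (+ 1) :* (:- x)) refl x) ((- 1#) ⊗ -x≈0)

    -‿onModel : ∀ {X Y T Z} → OnModel ⟨ X ∶ Y ∶ T ∶ Z ⟩ → OnModel ⟨ - X ∶ Y ∶ - T ∶ Z ⟩
    -‿onModel {X} {Y} {T} {Z} (quadric , segre) =
      (begin
        a * (- X) ^ 2 + Y ^ 2
          ≈⟨ solve 3 (λ a X Y → a :* (:- X :* :- X) :+ Y :* Y := a :* (X :* X) :+ Y :* Y) refl a X Y ⟩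
        a * X ^ 2 + Y ^ 2      ≈⟨ quadric ⟩
        Z ^ 2 + d * T ^ 2
          ≈⟨ solve 3 (λ d T Z → Z :* Z :+ d :* (T :* T) := Z :* Z :+ d :* (:- T :* :- T)) refl d T Z ⟩
        Z ^ 2 + d * (- T) ^ 2  ∎)
      , (begin
        - X * Y    ≈⟨ -‿distribˡ-* X Y ⟨
        - (X * Y)  ≈⟨ -‿cong segre ⟩
        - (Z * T)  ≈⟨ -‿distribʳ-* Z T ⟩
        Z * - T    ∎)
      where open RingProperties ring using (-‿distribˡ-*; -‿distribʳ-*)

  ι : AffinePoint → Point
  ι P = point ⟨ x ∶ y ∶ x * y ∶ 1# ⟩ (λ (_ , _ , _ , 1≈0) → 1≉0 1≈0) (ι-onModel onCurve)
    where open AffinePoint P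

  infix 8 ⊖_
  ⊖_ : Point → Point
  ⊖ point ⟨ X ∶ Y ∶ T ∶ Z ⟩ nonZero onModel =
    point ⟨ - X ∶ Y ∶ - T ∶ Z ⟩ (-‿nonZero nonZero) (-‿onModel onModel)

  -- The affine formula puts the sum at x = A / D and y = B / C; law₁ is its
  -- image under (x, y) ↦ (x : y : xy : 1), cleared of denominators.
  -- law₂ is the dual form of the same addition law: it agrees with law₁
  -- wherever both are defined, and no pair of points annihilates both
  -- (Hisil–Wong–Carter–Dawson 2008, Bernstein–Lange 2011).
  segre : (A B C D : Carrier) → Coordinates
  segre A B C D = ⟨ A * C ∶ B * D ∶ A * B ∶ C * D ⟩

  law₁ law₂ : Coordinates → Coordinates → Coordinates
  law₁ ⟨ X₁ ∶ Y₁ ∶ T₁ ∶ Z₁ ⟩ ⟨ X₂ ∶ Y₂ ∶ T₂ ∶ Z₂ ⟩ = segre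
    (X₁ * Y₂ + X₂ * Y₁) (Y₁ * Y₂ - a * X₁ * X₂)
    (Z₁ * Z₂ - d * T₁ * T₂) (Z₁ * Z₂ + d * T₁ * T₂)
  law₂ ⟨ X₁ ∶ Y₁ ∶ T₁ ∶ Z₁ ⟩ ⟨ X₂ ∶ Y₂ ∶ T₂ ∶ Z₂ ⟩ = segre
    (T₁ * Z₂ + T₂ * Z₁) (T₁ * Z₂ - T₂ * Z₁)
    (X₁ * Y₂ - X₂ * Y₁) (Y₁ * Y₂ + a * X₁ * X₂)

  abstract
    segre-onQuadric : ∀ A B C D → (A * C) * (B * D) ≈ (C * D) * (A * B)
    segre-onQuadric = solve 4 (λ A B C D → (A :* C) :* (B :* D) := (C :* D) :* (A :* B)) refl

  module _ {X₁ Y₁ T₁ Z₁ X₂ Y₂ T₂ Z₂}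
           (P : OnModel ⟨ X₁ ∶ Y₁ ∶ T₁ ∶ Z₁ ⟩) (Q : OnModel ⟨ X₂ ∶ Y₂ ∶ T₂ ∶ Z₂ ⟩) where

    private
      s₁ s₂ s₁′ s₂′ m₁ m₂ m₁′ m₂′ u : Carrier
      s₁  = a * X₁ ^ 2 + Y₁ ^ 2
      s₂  = a * X₂ ^ 2 + Y₂ ^ 2
      s₁′ = Z₁ ^ 2 + d * T₁ ^ 2
      s₂′ = Z₂ ^ 2 + d * T₂ ^ 2
      m₁  = X₁ * Y₁
      m₂  = X₂ * Y₂
      m₁′ = Z₁ * T₁
      m₂′ = Z₂ * T₂
      u   = (Y₁ ^ 2 - a * X₁ ^ 2) * (Y₂ ^ 2 - a * X₂ ^ 2)

      ss : s₁ * s₂ ≈ s₁′ * s₂′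
      ss = *-cong (proj₁ P) (proj₁ Q)

      mm : m₁ * m₂ ≈ m₁′ * m₂′
      mm = *-cong (proj₂ P) (proj₂ Q)

      ms : (m₁ * s₂) ^ 2 + (m₂ * s₁) ^ 2 ≈ (m₁′ * s₂′) ^ 2 + (m₂′ * s₁′) ^ 2
      ms = +-cong (*-cong e₁ e₁) (*-cong e₂ e₂)
        where e₁ = *-cong (proj₂ P) (proj₁ Q)
              e₂ = *-cong (proj₂ Q) (proj₁ P)

    abstract
      law₁-onModel : OnModel (law₁ ⟨ X₁ ∶ Y₁ ∶ T₁ ∶ Z₁ ⟩ ⟨ X₂ ∶ Y₂ ∶ T₂ ∶ Z₂ ⟩)
      law₁-onModel = (begin
        a * (A * C) ^ 2 + (B * D) ^ 2
          ≈⟨ solve 10 (λ a d X₁ Y₁ T₁ Z₁ X₂ Y₂ T₂ Z₂ →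
               let A = X₁ :* Y₂ :+ X₂ :* Y₁
                   B = Y₁ :* Y₂ :- a :* X₁ :* X₂
                   C = Z₁ :* Z₂ :- d :* T₁ :* T₂
                   D = Z₁ :* Z₂ :+ d :* T₁ :* T₂
                   s = (a :* (X₁ :* X₁) :+ Y₁ :* Y₁) :* (a :* (X₂ :* X₂) :+ Y₂ :* Y₂)
                   u = (Y₁ :* Y₁ :- a :* (X₁ :* X₁)) :* (Y₂ :* Y₂ :- a :* (X₂ :* X₂))
                   m = (X₁ :* Y₁) :* (X₂ :* Y₂)
                   n = (Z₁ :* T₁) :* (Z₂ :* T₂)
                   z = Z₁ :* Z₂
                   t = d :* T₁ :* T₂
               in a :* ((A :* C) :* (A :* C)) :+ (B :* D) :* (B :* D)
               := (z :* z :+ t :* t) :* s :+ (con (+ 2) :* d :* u) :* n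
                    :- (con (+ 8) :* a :* d :* n) :* m)
             refl a d X₁ Y₁ T₁ Z₁ X₂ Y₂ T₂ Z₂ ⟩
        (z ^ 2 + t ^ 2) * (s₁ * s₂) + (2 · 1# * d * u) * n - (8 · 1# * a * d * n) * (m₁ * m₂)
          ≈⟨ +-cong (+-congʳ (*-congˡ ss)) (-‿cong (*-congˡ mm)) ⟩
        (z ^ 2 + t ^ 2) * (s₁′ * s₂′) + (2 · 1# * d * u) * n - (8 · 1# * a * d * n) * n
          ≈⟨ solve 7 (λ a d T₁ Z₁ T₂ Z₂ u →
               let C = Z₁ :* Z₂ :- d :* T₁ :* T₂
                   D = Z₁ :* Z₂ :+ d :* T₁ :* T₂
                   s₁ = Z₁ :* Z₁ :+ d :* (T₁ :* T₁)
                   s₂ = Z₂ :* Z₂ :+ d :* (T₂ :* T₂)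
                   n = (Z₁ :* T₁) :* (Z₂ :* T₂)
                   z = Z₁ :* Z₂
                   t = d :* T₁ :* T₂
                   e₁ = (Z₁ :* T₁) :* s₂
                   e₂ = (Z₂ :* T₂) :* s₁
               in (z :* z :+ t :* t) :* (s₁ :* s₂) :+ (con (+ 2) :* d :* u) :* n
                    :- (con (+ 8) :* a :* d :* n) :* n
               := (C :* D) :* (C :* D) :+ d :* (e₁ :* e₁ :+ e₂ :* e₂)
                    :+ (con (+ 2) :* d :* u) :* n :- (con (+ 8) :* a :* d) :* (n :* n))
             refl a d T₁ Z₁ T₂ Z₂ u ⟩
        (C * D) ^ 2 + d * ((m₁′ * s₂′) ^ 2 + (m₂′ * s₁′) ^ 2)
          + (2 · 1# * d * u) * n - (8 · 1# * a * d) * (n * n)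
          ≈⟨ +-cong (+-cong (+-congˡ (*-congˡ ms)) (*-congˡ mm)) (-‿cong (*-congˡ (*-cong mm mm))) ⟨
        (C * D) ^ 2 + d * ((m₁ * s₂) ^ 2 + (m₂ * s₁) ^ 2)
          + (2 · 1# * d * u) * (m₁ * m₂) - (8 · 1# * a * d) * ((m₁ * m₂) * (m₁ * m₂))
          ≈⟨ solve 7 (λ a d X₁ Y₁ X₂ Y₂ CD →
               let A = X₁ :* Y₂ :+ X₂ :* Y₁
                   B = Y₁ :* Y₂ :- a :* X₁ :* X₂
                   s₁ = a :* (X₁ :* X₁) :+ Y₁ :* Y₁
                   s₂ = a :* (X₂ :* X₂) :+ Y₂ :* Y₂
                   u = (Y₁ :* Y₁ :- a :* (X₁ :* X₁)) :* (Y₂ :* Y₂ :- a :* (X₂ :* X₂))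
                   m = (X₁ :* Y₁) :* (X₂ :* Y₂)
                   e₁ = (X₁ :* Y₁) :* s₂
                   e₂ = (X₂ :* Y₂) :* s₁
               in CD :* CD :+ d :* (e₁ :* e₁ :+ e₂ :* e₂)
                    :+ (con (+ 2) :* d :* u) :* m :- (con (+ 8) :* a :* d) :* (m :* m)
               := CD :* CD :+ d :* ((A :* B) :* (A :* B)))
             refl a d X₁ Y₁ X₂ Y₂ (C * D) ⟩
        (C * D) ^ 2 + d * (A * B) ^ 2 ∎) , segre-onQuadric A B C D
        where
        A B C D n z t : Carrier
        A = X₁ * Y₂ + X₂ * Y₁
        B = Y₁ * Y₂ - a * X₁ * X₂
        C = Z₁ * Z₂ - d * T₁ * T₂
        D = Z₁ * Z₂ + d * T₁ * T₂
        n = m₁′ * m₂′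
        z = Z₁ * Z₂
        t = d * T₁ * T₂

      law₂-onModel : OnModel (law₂ ⟨ X₁ ∶ Y₁ ∶ T₁ ∶ Z₁ ⟩ ⟨ X₂ ∶ Y₂ ∶ T₂ ∶ Z₂ ⟩)
      law₂-onModel = (begin
        a * (A * C) ^ 2 + (B * D) ^ 2
          ≈⟨ solve 9 (λ a X₁ Y₁ T₁ Z₁ X₂ Y₂ T₂ Z₂ →
               let A = T₁ :* Z₂ :+ T₂ :* Z₁
                   B = T₁ :* Z₂ :- T₂ :* Z₁
                   C = X₁ :* Y₂ :- X₂ :* Y₁
                   D = Y₁ :* Y₂ :+ a :* X₁ :* X₂
                   s = (a :* (X₁ :* X₁) :+ Y₁ :* Y₁) :* (a :* (X₂ :* X₂) :+ Y₂ :* Y₂)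
                   u = (Y₁ :* Y₁ :- a :* (X₁ :* X₁)) :* (Y₂ :* Y₂ :- a :* (X₂ :* X₂))
                   m = (X₁ :* Y₁) :* (X₂ :* Y₂)
                   n = (Z₁ :* T₁) :* (Z₂ :* T₂)
                   p = (T₁ :* Z₂) :* (T₁ :* Z₂) :+ (T₂ :* Z₁) :* (T₂ :* Z₁)
               in a :* ((A :* C) :* (A :* C)) :+ (B :* D) :* (B :* D)
               := p :* s :- (con (+ 2) :* u) :* n :- (con (+ 8) :* a :* n) :* m)
             refl a X₁ Y₁ T₁ Z₁ X₂ Y₂ T₂ Z₂ ⟩
        p * (s₁ * s₂) - (2 · 1# * u) * n - (8 · 1# * a * n) * (m₁ * m₂)
          ≈⟨ +-cong (+-congʳ (*-congˡ ss)) (-‿cong (*-congˡ mm)) ⟩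
        p * (s₁′ * s₂′) - (2 · 1# * u) * n - (8 · 1# * a * n) * n
          ≈⟨ solve 7 (λ a d T₁ Z₁ T₂ Z₂ u →
               let A = T₁ :* Z₂ :+ T₂ :* Z₁
                   B = T₁ :* Z₂ :- T₂ :* Z₁
                   s₁ = Z₁ :* Z₁ :+ d :* (T₁ :* T₁)
                   s₂ = Z₂ :* Z₂ :+ d :* (T₂ :* T₂)
                   n = (Z₁ :* T₁) :* (Z₂ :* T₂)
                   p = (T₁ :* Z₂) :* (T₁ :* Z₂) :+ (T₂ :* Z₁) :* (T₂ :* Z₁)
                   e₁ = (Z₁ :* T₁) :* s₂
                   e₂ = (Z₂ :* T₂) :* s₁
               in p :* (s₁ :* s₂) :- (con (+ 2) :* u) :* n :- (con (+ 8) :* a :* n) :* n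
               := (e₁ :* e₁ :+ e₂ :* e₂) :- (con (+ 2) :* u) :* n
                    :- (con (+ 8) :* a) :* (n :* n) :+ d :* ((A :* B) :* (A :* B)))
             refl a d T₁ Z₁ T₂ Z₂ u ⟩
        ((m₁′ * s₂′) ^ 2 + (m₂′ * s₁′) ^ 2) - (2 · 1# * u) * n
          - (8 · 1# * a) * (n * n) + d * (A * B) ^ 2
          ≈⟨ +-congʳ (+-cong (+-cong ms (-‿cong (*-congˡ mm))) (-‿cong (*-congˡ (*-cong mm mm)))) ⟨
        ((m₁ * s₂) ^ 2 + (m₂ * s₁) ^ 2) - (2 · 1# * u) * (m₁ * m₂)
          - (8 · 1# * a) * ((m₁ * m₂) * (m₁ * m₂)) + d * (A * B) ^ 2
          ≈⟨ solve 7 (λ a d X₁ Y₁ X₂ Y₂ AB →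
               let C = X₁ :* Y₂ :- X₂ :* Y₁
                   D = Y₁ :* Y₂ :+ a :* X₁ :* X₂
                   s₁ = a :* (X₁ :* X₁) :+ Y₁ :* Y₁
                   s₂ = a :* (X₂ :* X₂) :+ Y₂ :* Y₂
                   u = (Y₁ :* Y₁ :- a :* (X₁ :* X₁)) :* (Y₂ :* Y₂ :- a :* (X₂ :* X₂))
                   m = (X₁ :* Y₁) :* (X₂ :* Y₂)
                   e₁ = (X₁ :* Y₁) :* s₂
                   e₂ = (X₂ :* Y₂) :* s₁
               in (e₁ :* e₁ :+ e₂ :* e₂) :- (con (+ 2) :* u) :* m
                    :- (con (+ 8) :* a) :* (m :* m) :+ d :* (AB :* AB)
               := (C :* D) :* (C :* D) :+ d :* (AB :* AB))
             refl a d X₁ Y₁ X₂ Y₂ (A * B) ⟩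
        (C * D) ^ 2 + d * (A * B) ^ 2 ∎) , segre-onQuadric A B C D
        where
        A B C D n p : Carrier
        A = T₁ * Z₂ + T₂ * Z₁
        B = T₁ * Z₂ - T₂ * Z₁
        C = X₁ * Y₂ - X₂ * Y₁
        D = Y₁ * Y₂ + a * X₁ * X₂
        n = m₁′ * m₂′
        p = (T₁ * Z₂) ^ 2 + (T₂ * Z₁) ^ 2

  abstract
    2≉0 : 2 · 1# ≉ 0#
    2≉0 2≈0 = excluded (proj₁ odd) (to (char 2) 2≈0) (proj₂ (proj₂ odd)) (from (char 1))
      where
      open Equivalence
      char : HasCharacteristic (proj₁ odd)
      char = proj₁ (proj₂ odd)
      excluded : ∀ p → p ∣ 2 → ¬ 2 ∣ p → ¬ (p ∣ 1 → 1# ≈ 0#)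
      excluded 0 _ 2∤0 _ = 2∤0 (2 ∣0)
      excluded 1 _ _ 1≈0 = 1≉0 (1≈0 ∣-refl)
      excluded 2 _ 2∤2 _ = 2∤2 ∣-refl
      excluded (suc (suc (suc _))) p∣2 _ _ with s≤s (s≤s ()) ← ∣⇒≤ p∣2

    a≉0 : a ≉ 0#
    a≉0 a≈0 = ad[a-d]≉0 (trans (solve 2 (λ a d → a :* d :* (a :- d) := d :* (a :- d) :* a) refl a d)
                               ((d * (a - d)) ⊗ a≈0))

    d≉0 : d ≉ 0#
    d≉0 d≈0 = ad[a-d]≉0 (trans (solve 2 (λ a d → a :* d :* (a :- d) := a :* (a :- d) :* d) refl a d)
                               ((a * (a - d)) ⊗ d≈0))

    a-d≉0 : a - d ≉ 0#
    a-d≉0 a-d≈0 = ad[a-d]≉0 ((a * d) ⊗ a-d≈0)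

    form≉0 : ∀ {k x y} → k ≉ 0# → ¬ (x ≈ 0# × y ≈ 0#) →
             k * x ^ 2 + y ^ 2 ≈ 0# → x * y ≉ 0#
    form≉0 {k} {x} {y} k≉0 xy≉0 kxx+yy≈0 x*y≈0 with zero-product x*y≈0
    ... | inj₁ x≈0 = xy≉0 (x≈0 , square≈0 (trans
            (solve 3 (λ k x y → y :* y := (k :* (x :* x) :+ y :* y) :+ (:- (k :* x)) :* x) refl k x y)
            (kxx+yy≈0 ⊞ (- (k * x)) ⊗ x≈0)))
    ... | inj₂ y≈0 = xy≉0 (square≈0 (cancel-≉0 k≉0 (trans
            (solve 3 (λ k x y → k :* (x :* x) := (k :* (x :* x) :+ y :* y) :+ (:- y) :* y) refl k x y)
            (kxx+yy≈0 ⊞ (- y) ⊗ y≈0))) , y≈0)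

    module _ {X Y T Z} (P≉0 : NonZero ⟨ X ∶ Y ∶ T ∶ Z ⟩) (P : OnModel ⟨ X ∶ Y ∶ T ∶ Z ⟩) where

      quadric≈0 : (a * X ^ 2 + Y ^ 2) - (Z ^ 2 + d * T ^ 2) ≈ 0#
      quadric≈0 = x≈y⇒x-y≈0 (proj₁ P)

      XY≉0 : ¬ (X ≈ 0# × Y ≈ 0#)
      XY≉0 (X≈0 , Y≈0) = form≉0 d≉0 (λ (T≈0 , Z≈0) → P≉0 (X≈0 , Y≈0 , T≈0 , Z≈0))
        (trans (solve 6 (λ a d X Y T Z → d :* (T :* T) :+ Z :* Z
                 := (:- con (+ 1)) :* ((a :* (X :* X) :+ Y :* Y) :- (Z :* Z :+ d :* (T :* T)))
                    :+ (a :* X) :* X :+ Y :* Y) refl a d X Y T Z)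
               ((- 1#) ⊗ quadric≈0 ⊞ (a * X) ⊗ X≈0 ⊞ Y ⊗ Y≈0))
        (trans (*-comm T Z) (trans (sym (proj₂ P)) (X ⊗ Y≈0)))

      TZ≉0 : ¬ (T ≈ 0# × Z ≈ 0#)
      TZ≉0 (T≈0 , Z≈0) = form≉0 a≉0 (λ (X≈0 , Y≈0) → P≉0 (X≈0 , Y≈0 , T≈0 , Z≈0))
        (trans (solve 6 (λ a d X Y T Z → a :* (X :* X) :+ Y :* Y
                 := ((a :* (X :* X) :+ Y :* Y) :- (Z :* Z :+ d :* (T :* T)))
                    :+ (d :* T) :* T :+ Z :* Z) refl a d X Y T Z)
               (quadric≈0 ⊞ (d * T) ⊗ T≈0 ⊞ Z ⊗ Z≈0))
        (trans (proj₂ P) (Z ⊗ T≈0))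

      vanishing-both : Y ^ 2 - a * X ^ 2 ≈ 0# → Z ^ 2 - d * T ^ 2 ≈ 0# → ⊥
      vanishing-both Y²≈aX² Z²≈dT² = TZ≉0 (T≈0 , Z≈0)
        where
        T≈0 : T ≈ 0#
        T≈0 = square≈0 (square≈0 (cancel-≉0 a-d≉0 (cancel-≉0 d≉0 (cancel-≉0 2≉0 (trans
          (solve 6 (λ a d X Y T Z →
             let q = (a :* (X :* X) :+ Y :* Y) :- (Z :* Z :+ d :* (T :* T))
                 f = Y :* Y :- a :* (X :* X)
                 g = Z :* Z :- d :* (T :* T)
                 m = X :* Y :- Z :* T
                 h = a :* (X :* X) :+ d :* (T :* T)
             in con (+ 2) :* (d :* ((a :- d) :* ((T :* T) :* (T :* T))))
             := h :* q :+ (:- con (+ 2) :* a :* (X :* Y :+ Z :* T)) :* m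
                  :+ (con (+ 2) :* a :* (X :* X) :- h) :* f
                  :+ (h :- con (+ 2) :* a :* (T :* T)) :* g)
             refl a d X Y T Z)
          (h ⊗ quadric≈0 ⊞ (- (2 · 1#) * a * (X * Y + Z * T)) ⊗ x≈y⇒x-y≈0 (proj₂ P)
             ⊞ (2 · 1# * a * X ^ 2 - h) ⊗ Y²≈aX² ⊞ (h - 2 · 1# * a * T ^ 2) ⊗ Z²≈dT²))))))
          where
          h : Carrier
          h = a * X ^ 2 + d * T ^ 2
        Z≈0 : Z ≈ 0#
        Z≈0 = square≈0 (trans
          (solve 3 (λ d T Z → Z :* Z := (Z :* Z :- d :* (T :* T)) :+ (d :* T) :* T) refl d T Z)
          (Z²≈dT² ⊞ (d * T) ⊗ T≈0))

      vanishing-one : Z ^ 2 + d * T ^ 2 ≈ 0# → X * Y ≉ 0#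
      vanishing-one Z²≈-dT² = form≉0 a≉0 XY≉0 (trans (proj₁ P) Z²≈-dT²)

    -- The hypotheses say that (x₁ : y₁) is both (∓ x₂ : y₂) and (y₂ : ∓ k x₂).
    proportional⁺ : ∀ {k x₁ y₁ x₂ y₂} → ¬ (x₁ ≈ 0# × y₁ ≈ 0#) →
                    x₁ * y₂ + x₂ * y₁ ≈ 0# → y₁ * y₂ + k * x₁ * x₂ ≈ 0# → y₂ ^ 2 - k * x₂ ^ 2 ≈ 0#
    proportional⁺ {k} {x₁} {y₁} {x₂} {y₂} xy≉0 f≈0 g≈0 with x₁ ≟ 0#
    ... | no x₁≉0 = cancel-≉0 x₁≉0 (trans
      (solve 5 (λ k x₁ y₁ x₂ y₂ → x₁ :* (y₂ :* y₂ :- k :* (x₂ :* x₂))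
         := y₂ :* (x₁ :* y₂ :+ x₂ :* y₁) :+ (:- x₂) :* (y₁ :* y₂ :+ k :* x₁ :* x₂))
         refl k x₁ y₁ x₂ y₂)
      (y₂ ⊗ f≈0 ⊞ (- x₂) ⊗ g≈0))
    ... | yes x₁≈0 = cancel-≉0 (λ y₁≈0 → xy≉0 (x₁≈0 , y₁≈0)) (trans
      (solve 5 (λ k x₁ y₁ x₂ y₂ → y₁ :* (y₂ :* y₂ :- k :* (x₂ :* x₂))
         := y₂ :* (y₁ :* y₂ :+ k :* x₁ :* x₂) :+ (:- (k :* x₂)) :* (x₁ :* y₂ :+ x₂ :* y₁))
         refl k x₁ y₁ x₂ y₂)
      (y₂ ⊗ g≈0 ⊞ (- (k * x₂)) ⊗ f≈0))

    proportional⁻ : ∀ {k x₁ y₁ x₂ y₂} → ¬ (x₁ ≈ 0# × y₁ ≈ 0#) →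
                    x₁ * y₂ - x₂ * y₁ ≈ 0# → y₁ * y₂ - k * x₁ * x₂ ≈ 0# → y₂ ^ 2 - k * x₂ ^ 2 ≈ 0#
    proportional⁻ {k} {x₁} {y₁} {x₂} {y₂} xy≉0 f≈0 g≈0 = trans
      (solve 3 (λ k x y → y :* y :- k :* (x :* x) := y :* y :- k :* (:- x :* :- x)) refl k x₂ y₂)
      (proportional⁺ xy≉0
        (trans (solve 4 (λ x₁ y₁ x₂ y₂ → x₁ :* y₂ :+ (:- x₂) :* y₁ := x₁ :* y₂ :- x₂ :* y₁)
                  refl x₁ y₁ x₂ y₂) f≈0)
        (trans (solve 5 (λ k x₁ y₁ x₂ y₂ → y₁ :* y₂ :+ k :* x₁ :* (:- x₂) := y₁ :* y₂ :- k :* x₁ :* x₂)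
                  refl k x₁ y₁ x₂ y₂) g≈0))

    segre-zero : ∀ {A B C D} → A * C ≈ 0# × B * D ≈ 0# × A * B ≈ 0# × C * D ≈ 0# →
                 (A ≈ 0# × D ≈ 0#) ⊎ (B ≈ 0# × C ≈ 0#)
    segre-zero {A} {B} {C} {D} (AC≈0 , BD≈0 , AB≈0 , CD≈0) with A ≟ 0# | D ≟ 0#
    ... | yes A≈0 | yes D≈0 = inj₁ (A≈0 , D≈0)
    ... | no  A≉0 | _       = inj₂ (cancel-≉0 A≉0 AB≈0 , cancel-≉0 A≉0 AC≈0)
    ... | _       | no  D≉0 = inj₂ (cancel-≉0 D≉0 (trans (*-comm D B) BD≈0)
                                   , cancel-≉0 D≉0 (trans (*-comm D C) CD≈0))

    halve : ∀ {x y z} → y ≈ 0# → z ≈ 0# → 2 · 1# * x ≈ y + z → x ≈ 0#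
    halve y≈0 z≈0 2x≈y+z = cancel-≉0 2≉0 (trans 2x≈y+z (y≈0 ⊞ z≈0))

    complete : (P Q : Point) → let open Point in
               ¬ NonZero (law₁ (coordinates P) (coordinates Q)) →
               NonZero (law₂ (coordinates P) (coordinates Q))
    complete (point ⟨ X₁ ∶ Y₁ ∶ T₁ ∶ Z₁ ⟩ P≉0 P) (point ⟨ X₂ ∶ Y₂ ∶ T₂ ∶ Z₂ ⟩ Q≉0 Q) ¬¬law₁≈0 law₂≈0 =
      ¬¬law₁≈0 (λ law₁≈0 → absurd (segre-zero law₁≈0) (segre-zero law₂≈0))
      where
      XY₁≉0 : ¬ (X₁ ≈ 0# × Y₁ ≈ 0#)
      XY₁≉0 = XY≉0 P≉0 P

      TZ₁≉0 : ¬ (T₁ ≈ 0# × Z₁ ≈ 0#)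
      TZ₁≉0 = TZ≉0 P≉0 P

      zero-factors : X₁ * Y₂ ≈ 0# → X₂ * Y₁ ≈ 0# → X₂ * Y₂ ≈ 0#
      zero-factors X₁Y₂≈0 X₂Y₁≈0 with X₁ ≟ 0#
      ... | no  X₁≉0 = X₂ ⊗ cancel-≉0 X₁≉0 X₁Y₂≈0
      ... | yes X₁≈0 = trans (*-comm X₂ Y₂) (Y₂ ⊗ cancel-≉0 (λ Y₁≈0 → XY₁≉0 (X₁≈0 , Y₁≈0))
                                                    (trans (*-comm Y₁ X₂) X₂Y₁≈0))

      zero-factors′ : X₁ * X₂ ≈ 0# → Y₁ * Y₂ ≈ 0# → X₂ * Y₂ ≈ 0#
      zero-factors′ X₁X₂≈0 Y₁Y₂≈0 with X₁ ≟ 0#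
      ... | no  X₁≉0 = trans (*-comm X₂ Y₂) (Y₂ ⊗ cancel-≉0 X₁≉0 X₁X₂≈0)
      ... | yes X₁≈0 = X₂ ⊗ cancel-≉0 (λ Y₁≈0 → XY₁≉0 (X₁≈0 , Y₁≈0)) Y₁Y₂≈0

      form⁺ : Z₂ ^ 2 - (- d) * T₂ ^ 2 ≈ 0# → Z₂ ^ 2 + d * T₂ ^ 2 ≈ 0#
      form⁺ = trans (solve 3 (λ d T Z → Z :* Z :+ d :* (T :* T) := Z :* Z :- (:- d) :* (T :* T))
                       refl d T₂ Z₂)

      absurd : (X₁ * Y₂ + X₂ * Y₁ ≈ 0# × Z₁ * Z₂ + d * T₁ * T₂ ≈ 0#)
                 ⊎ (Y₁ * Y₂ - a * X₁ * X₂ ≈ 0# × Z₁ * Z₂ - d * T₁ * T₂ ≈ 0#) →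
               (T₁ * Z₂ + T₂ * Z₁ ≈ 0# × Y₁ * Y₂ + a * X₁ * X₂ ≈ 0#)
                 ⊎ (T₁ * Z₂ - T₂ * Z₁ ≈ 0# × X₁ * Y₂ - X₂ * Y₁ ≈ 0#) → ⊥
      absurd (inj₁ (A≈0 , D≈0)) (inj₁ (A′≈0 , D′≈0)) =
        vanishing-both Q≉0 Q (proportional⁺ XY₁≉0 A≈0 D′≈0) (proportional⁺ TZ₁≉0 A′≈0 D≈0)
      absurd (inj₂ (B≈0 , C≈0)) (inj₂ (B′≈0 , C′≈0)) =
        vanishing-both Q≉0 Q (proportional⁻ XY₁≉0 C′≈0 B≈0) (proportional⁻ TZ₁≉0 B′≈0 C≈0)
      absurd (inj₁ (A≈0 , D≈0)) (inj₂ (B′≈0 , C′≈0)) =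
        vanishing-one Q≉0 Q
          (form⁺ (proportional⁻ TZ₁≉0 B′≈0 (trans
            (solve 5 (λ d T₁ Z₁ T₂ Z₂ → Z₁ :* Z₂ :- (:- d) :* T₁ :* T₂ := Z₁ :* Z₂ :+ d :* T₁ :* T₂)
               refl d T₁ Z₁ T₂ Z₂) D≈0)))
          (zero-factors
            (halve A≈0 C′≈0 (solve 4 (λ X₁ Y₁ X₂ Y₂ → con (+ 2) :* (X₁ :* Y₂)
               := (X₁ :* Y₂ :+ X₂ :* Y₁) :+ (X₁ :* Y₂ :- X₂ :* Y₁)) refl X₁ Y₁ X₂ Y₂))
            (halve A≈0 ((- 1#) ⊗ C′≈0) (solve 4 (λ X₁ Y₁ X₂ Y₂ → con (+ 2) :* (X₂ :* Y₁)
               := (X₁ :* Y₂ :+ X₂ :* Y₁) :+ (:- con (+ 1)) :* (X₁ :* Y₂ :- X₂ :* Y₁))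
               refl X₁ Y₁ X₂ Y₂)))
      absurd (inj₂ (B≈0 , C≈0)) (inj₁ (A′≈0 , D′≈0)) =
        vanishing-one Q≉0 Q
          (form⁺ (proportional⁺ TZ₁≉0 A′≈0 (trans
            (solve 5 (λ d T₁ Z₁ T₂ Z₂ → Z₁ :* Z₂ :+ (:- d) :* T₁ :* T₂ := Z₁ :* Z₂ :- d :* T₁ :* T₂)
               refl d T₁ Z₁ T₂ Z₂) C≈0)))
          (zero-factors′
            (cancel-≉0 a≉0 (halve D′≈0 ((- 1#) ⊗ B≈0) (solve 5 (λ a X₁ Y₁ X₂ Y₂ →
               con (+ 2) :* (a :* (X₁ :* X₂))
               := (Y₁ :* Y₂ :+ a :* X₁ :* X₂) :+ (:- con (+ 1)) :* (Y₁ :* Y₂ :- a :* X₁ :* X₂))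
               refl a X₁ Y₁ X₂ Y₂)))
            (halve D′≈0 B≈0 (solve 5 (λ a X₁ Y₁ X₂ Y₂ → con (+ 2) :* (Y₁ :* Y₂)
               := (Y₁ :* Y₂ :+ a :* X₁ :* X₂) :+ (Y₁ :* Y₂ :- a :* X₁ :* X₂))
               refl a X₁ Y₁ X₂ Y₂)))

  nonZero? : ∀ q → Dec (NonZero q)
  nonZero? ⟨ X ∶ Y ∶ T ∶ Z ⟩ = ¬? (X ≟ 0# ×-dec Y ≟ 0# ×-dec T ≟ 0# ×-dec Z ≟ 0#)

  choose : (P Q : Point) → let open Point in
           Dec (NonZero (law₁ (coordinates P) (coordinates Q))) → Point
  choose P Q (yes law₁≉0) = point _ law₁≉0 (law₁-onModel (Point.onModel P) (Point.onModel Q))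
  choose P Q (no  law₁≈0) = point _ (complete P Q law₁≈0) (law₂-onModel (Point.onModel P) (Point.onModel Q))

  infixl 6 _⊕_ _⊝_
  _⊕_ : Point → Point → Point
  P ⊕ Q = choose P Q (nonZero? (law₁ (coordinates P) (coordinates Q)))
    where open Point

  _⊝_ : Point → Point → Point
  P ⊝ Q = P ⊕ ⊖ Q

  ⊕-affine : (P Q : AffinePoint) → let open AffinePoint P renaming (x to x₁; y to y₁)
                                       open AffinePoint Q renaming (x to x₂; y to y₂)
                                       open Point (ι P ⊕ ι Q) in
             1# + d * x₁ * x₂ * y₁ * y₂ ≉ 0# → 1# - d * x₁ * x₂ * y₁ * y₂ ≉ 0# →
             Z ≉ 0#
             × X / Z ≈ (x₁ * y₂ + x₂ * y₁) / (1# + d * x₁ * x₂ * y₁ * y₂)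
             × Y / Z ≈ (y₁ * y₂ - a * x₁ * x₂) / (1# - d * x₁ * x₂ * y₁ * y₂)
  ⊕-affine P Q D≉0 C≉0 = helper (nonZero? (law₁ (coordinates (ι P)) (coordinates (ι Q))))
    where
    open AffinePoint P renaming (x to x₁; y to y₁)
    open AffinePoint Q renaming (x to x₂; y to y₂)
    open Point using (coordinates)
    C D : Carrier
    C = 1# * 1# - d * (x₁ * y₁) * (x₂ * y₂)
    D = 1# * 1# + d * (x₁ * y₁) * (x₂ * y₂)
    C≈ : 1# - d * x₁ * x₂ * y₁ * y₂ ≈ C
    C≈ = solve 5 (λ d x₁ x₂ y₁ y₂ → con (+ 1) :- d :* x₁ :* x₂ :* y₁ :* y₂
           := con (+ 1) :* con (+ 1) :- d :* (x₁ :* y₁) :* (x₂ :* y₂)) refl d x₁ x₂ y₁ y₂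
    D≈ : 1# + d * x₁ * x₂ * y₁ * y₂ ≈ D
    D≈ = solve 5 (λ d x₁ x₂ y₁ y₂ → con (+ 1) :+ d :* x₁ :* x₂ :* y₁ :* y₂
           := con (+ 1) :* con (+ 1) :+ d :* (x₁ :* y₁) :* (x₂ :* y₂)) refl d x₁ x₂ y₁ y₂
    CD≉0 : C * D ≉ 0#
    CD≉0 = *-≉0 (λ C≈0 → C≉0 (trans C≈ C≈0)) (λ D≈0 → D≉0 (trans D≈ D≈0))
    helper : ∀ dec → let open Point (choose (ι P) (ι Q) dec) in
             Z ≉ 0#
             × X / Z ≈ (x₁ * y₂ + x₂ * y₁) / (1# + d * x₁ * x₂ * y₁ * y₂)
             × Y / Z ≈ (y₁ * y₂ - a * x₁ * x₂) / (1# - d * x₁ * x₂ * y₁ * y₂)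
    helper (no law₁≈0) = ⊥-elim (law₁≈0 (λ (_ , _ , _ , CD≈0) → CD≉0 CD≈0))
    helper (yes _)     = CD≉0
                       , /-cross CD≉0 D≉0 (trans (*-congˡ D≈) (*-assoc _ C D))
                       , /-cross CD≉0 C≉0 (trans (*-congˡ C≈)
                                             (trans (*-assoc _ D C) (*-congˡ (*-comm D C))))

  w : AffinePoint → Carrier
  w P = d * x ^ 2 * y ^ 2
    where open AffinePoint P

  -- The extension of w to the whole model, with nothing as the value ∞.
  w∞ : Point → Maybe Carrier
  w∞ P with Z ≟ 0#
    where open Point P
  ... | yes _ = nothing
  ... | no  _ = just (d * (X / Z) ^ 2 * (Y / Z) ^ 2)
    where open Point P

  infix 4 _≈∞_
  _≈∞_ : Maybe Carrier → Maybe Carrier → Set (c ⊔ ℓ)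
  _≈∞_ = Pointwise _≈_

{-# OPTIONS --safe #-}

-- On the curve, t = xy satisfies w = d t², and v = y² − a x² satisfies
-- v² = (1 + w)² − e w. The addition law has T = t₁ v₂ ± t₂ v₁ and
-- Z = 1 − w₁ w₂ for P₁ ± P₂, so w(P₁ ± P₂) = d (t₁ v₂ ± t₂ v₁)² / (1 − w₁ w₂)²,
-- where d (t₁ v₂)² = w₁ v₂² and d (t₂ v₁)² = w₂ v₁² are polynomials in w₁, w₂, e.
module Submission where

open import Defs
open import Data.Empty using (⊥-elim)
open import Data.Integer using (+_)
open import Data.Maybe using (just)
open import Data.Maybe.Relation.Binary.Pointwise using (just)
open import Data.Product using (∃; _×_; _,_; proj₁; proj₂)
open import Relation.Binary.PropositionalEquality as ≡ using (_≡_)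
import Relation.Binary.Reasoning.Setoid as ≈-Reasoning
open import Relation.Nullary using (yes; no)

module _ {c ℓ} (F : FiniteField c ℓ) (odd : FiniteField.OddCharacteristic F)
         (a d : FiniteField.Carrier F) (ad[a-d]≉0 : NonDegenerate F a d) where

  open FiniteField F
  open FieldProperties F
  open TwistedEdwards F odd a d ad[a-d]≉0
  open ≈-Reasoning setoid

  e : Carrier
  e = 4 · a / d

  -x≈0⇒x≈0 : ∀ {x} → - x ≈ 0# → x ≈ 0#
  -x≈0⇒x≈0 {x} -x≈0 =
    trans (solve 1 (λ x → x := :- con (+ 1) :* (:- x)) refl x) ((- 1#) ⊗ -x≈0)

  -- The sign accounts for Z = 1 − w₁ w₂ against the denominator (w₁ w₂ − 1)².
  w∞-finite : ∀ R {t z} → let open Point R in z ≉ 0# → T ≈ t → Z ≈ - z →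
              w∞ R ≈∞ just (d * t ^ 2 / z ^ 2)
  w∞-finite R {t} {z} z≉0 T≈t Z≈-z with Point.Z R ≟ 0#
  ... | yes Z≈0 = ⊥-elim (z≉0 (-x≈0⇒x≈0 (trans (sym Z≈-z) Z≈0)))
  ... | no  Z≉0 = just (begin
    d * (X * i) ^ 2 * (Y * i) ^ 2
      ≈⟨ solve 4 (λ d X Y i → d :* ((X :* i) :* (X :* i)) :* ((Y :* i) :* (Y :* i))
                    := d :* ((X :* Y) :* (X :* Y)) :* ((i :* i) :* (i :* i))) refl d X Y i ⟩
    d * (X * Y) ^ 2 * (i ^ 2) ^ 2
      -- The model relation `X Y = Z T` makes the value depend on `T / Z` alone.
      ≈⟨ *-congʳ (*-congˡ (*-cong XY≈ZT XY≈ZT)) ⟩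
    d * (Z * T) ^ 2 * (i ^ 2) ^ 2
      ≈⟨ solve 4 (λ d Z T i → d :* ((Z :* T) :* (Z :* T)) :* ((i :* i) :* (i :* i))
                    := d :* (T :* T) :* ((Z :* i) :* (Z :* i) :* (i :* i))) refl d Z T i ⟩
    d * T ^ 2 * ((Z * i) ^ 2 * i ^ 2)
      ≈⟨ *-cong (*-congˡ (*-cong T≈t T≈t)) (*-congʳ (trans (*-cong Zi≈1 Zi≈1) (*-identityˡ 1#))) ⟩
    d * t ^ 2 * (1# * i ^ 2)
      ≈⟨ *-congˡ (*-congˡ i²≈) ⟩
    d * t ^ 2 * (1# * (z ^ 2) ⁻¹)
      ≈⟨ *-congˡ (*-identityˡ _) ⟩
    d * t ^ 2 / z ^ 2  ∎)
    where
    open Point R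
    i : Carrier
    i = Z ⁻¹
    Zi≈1 : Z * i ≈ 1#
    Zi≈1 = ⁻¹-inverseʳ Z≉0
    XY≈ZT : X * Y ≈ Z * T
    XY≈ZT = proj₂ onModel
    i²≈ : i ^ 2 ≈ (z ^ 2) ⁻¹
    i²≈ = begin
      i ^ 2                            ≈⟨ *-identityʳ _ ⟨
      i ^ 2 * 1#                       ≈⟨ *-congˡ (⁻¹-inverseʳ (*-≉0 z≉0 z≉0)) ⟨
      i ^ 2 * (z ^ 2 * (z ^ 2) ⁻¹)
        ≈⟨ solve 3 (λ i z j → i :* i :* (z :* z :* j)
                      := (:- z :* i) :* (:- z :* i) :* j) refl i z ((z ^ 2) ⁻¹) ⟩
      (- z * i) ^ 2 * (z ^ 2) ⁻¹
        ≈⟨ *-congʳ (*-cong (*-congʳ Z≈-z) (*-congʳ Z≈-z)) ⟨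
      (Z * i) ^ 2 * (z ^ 2) ⁻¹         ≈⟨ *-congʳ (*-cong Zi≈1 Zi≈1) ⟩
      1# * 1# * (z ^ 2) ⁻¹             ≈⟨ trans (*-congʳ (*-identityˡ 1#)) (*-identityˡ _) ⟩
      (z ^ 2) ⁻¹                       ∎

  -- A nonzero `Z` excludes the branch of `choose` that falls back on `law₂`. The helper abstracts
  -- over the decision, so that matching on it lets `choose` reduce.
  ⊕≡law₁ : ∀ P Q → let open Point using (coordinates)
                       P+Q = law₁ (coordinates P) (coordinates Q) in
           Coordinates.Z P+Q ≉ 0# → coordinates (P ⊕ Q) ≡ P+Q
  ⊕≡law₁ P Q Z≉0 = helper (nonZero? (law₁ (coordinates P) (coordinates Q)))
    where
    open Point using (coordinates)
    helper : ∀ dec → coordinates (choose P Q dec) ≡ law₁ (coordinates P) (coordinates Q)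
    helper (yes _)      = ≡.refl
    helper (no  law₁≈0) = ⊥-elim (law₁≈0 (λ (_ , _ , _ , Z≈0) → Z≉0 Z≈0))

  -- Reduces `w∞` of a sum to two polynomial identities, one for each of the coordinates `T` and `Z`
  -- of `law₁`.
  w∞-⊕ : ∀ P Q {t z} → let open Point using (coordinates)
                           open Coordinates (law₁ (coordinates P) (coordinates Q)) in
         z ≉ 0# → T ≈ t → Z ≈ - z → w∞ (P ⊕ Q) ≈∞ just (d * t ^ 2 / z ^ 2)
  w∞-⊕ P Q {z = z} z≉0 T≈t Z≈-z = w∞-finite (P ⊕ Q) z≉0
    (trans (reflexive (≡.cong Coordinates.T law)) T≈t)
    (trans (reflexive (≡.cong Coordinates.Z law)) Z≈-z)
    where
    law = ⊕≡law₁ P Q λ Z≈0 → z≉0 (-x≈0⇒x≈0 (trans (sym Z≈-z) Z≈0))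

  t v : AffinePoint → Carrier
  t P = x * y where open AffinePoint P
  v P = y ^ 2 - a * x ^ 2 where open AffinePoint P

  -- `v² = (a x² + y²)² - 4 a x² y²`. The curve equation turns the first square into `(w + 1)²`, and
  -- `4 a x² y² = e w` because `e d = 4 a`.
  v² : ∀ P → v P ^ 2 ≈ (w P + 1#) ^ 2 - e * w P
  v² P = begin
    (y ^ 2 - a * x ^ 2) ^ 2
      ≈⟨ solve 3 (λ a x y →
           let f = y :* y :- a :* (x :* x)
               s = a :* (x :* x) :+ y :* y
           in f :* f := s :* s :- con (+ 4) :* a :* (x :* x :* (y :* y))) refl a x y ⟩
    (a * x ^ 2 + y ^ 2) ^ 2 - 4 · 1# * a * (x ^ 2 * y ^ 2)
      ≈⟨ +-cong (*-cong s≈ s≈) (-‿cong 4at²≈ew) ⟩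
    (w P + 1#) ^ 2 - e * w P  ∎
    where
    open AffinePoint P
    s≈ : a * x ^ 2 + y ^ 2 ≈ w P + 1#
    s≈ = trans onCurve (+-comm 1# _)
    4at²≈ew : 4 · 1# * a * (x ^ 2 * y ^ 2) ≈ e * w P
    4at²≈ew = begin
      4 · 1# * a * (x ^ 2 * y ^ 2)              ≈⟨ *-identityʳ _ ⟨
      4 · 1# * a * (x ^ 2 * y ^ 2) * 1#         ≈⟨ *-congˡ (⁻¹-inverseʳ d≉0) ⟨
      4 · 1# * a * (x ^ 2 * y ^ 2) * (d * d ⁻¹)
        -- `4 · a` unfolds to `a + a + a + a`, while `con (+ 4)` evaluates to `4 · 1#`; the solver
        -- identifies the two.
        ≈⟨ solve 5 (λ a d x y i →
             con (+ 4) :* a :* (x :* x :* (y :* y)) :* (d :* i)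
             := (a :+ a :+ a :+ a) :* i :* (d :* (x :* x) :* (y :* y)))
             refl a d x y (d ⁻¹) ⟩
      4 · a * d ⁻¹ * w P                        ∎

  dt²v² : ∀ P Q → d * (t P * v Q) ^ 2 ≈ w P * ((w Q + 1#) ^ 2 - e * w Q)
  dt²v² P Q = begin
    d * (t P * v Q) ^ 2
      ≈⟨ solve 4 (λ d x y v → d :* ((x :* y :* v) :* (x :* y :* v))
                    := d :* (x :* x) :* (y :* y) :* (v :* v)) refl d x y (v Q) ⟩
    w P * v Q ^ 2                         ≈⟨ *-congˡ (v² Q) ⟩
    w P * ((w Q + 1#) ^ 2 - e * w Q)      ∎
    where open AffinePoint P

  -- `T = A * B` regroups as `t₁ v₂ + t₂ v₁`. `Z = C * D` is `1 - s²` with `s = d t₁ t₂`, and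
  -- `s² = w₁ w₂`. The case `P = Q` covers doubling.
  w∞-sum : ∀ P Q → w P * w Q - 1# ≉ 0# →
           w∞ (ι P ⊕ ι Q) ≈∞ just (d * (t P * v Q + t Q * v P) ^ 2 / (w P * w Q - 1#) ^ 2)
  w∞-sum P Q wPwQ-1≉0 = w∞-⊕ (ι P) (ι Q) wPwQ-1≉0
    (solve 5 (λ a x₁ y₁ x₂ y₂ →
       (x₁ :* y₂ :+ x₂ :* y₁) :* (y₁ :* y₂ :- a :* x₁ :* x₂)
       := x₁ :* y₁ :* (y₂ :* y₂ :- a :* (x₂ :* x₂)) :+ x₂ :* y₂ :* (y₁ :* y₁ :- a :* (x₁ :* x₁)))
       refl a x₁ y₁ x₂ y₂)
    (solve 5 (λ d x₁ y₁ x₂ y₂ →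
       -- `ι` puts `1#` in the `Z` coordinate, so `law₁` contains the unreduced product `1# * 1#`.
       let 1² = con (+ 1) :* con (+ 1)
           s  = d :* (x₁ :* y₁) :* (x₂ :* y₂)
       in (1² :- s) :* (1² :+ s)
       := :- (d :* (x₁ :* x₁) :* (y₁ :* y₁) :* (d :* (x₂ :* x₂) :* (y₂ :* y₂)) :- con (+ 1)))
       refl d x₁ y₁ x₂ y₂)
    where
    open AffinePoint P renaming (x to x₁; y to y₁)
    open AffinePoint Q renaming (x to x₂; y to y₂)

  -- Negating `P` flips `x₁` and hence `t₁`, but fixes `v₁`. In `Z` only the sign of `s` changes, so
  -- the denominator is that of the sum.
  w∞-difference : ∀ P Q → w P * w Q - 1# ≉ 0# →
                  w∞ (ι Q ⊝ ι P) ≈∞ just (d * (t Q * v P - t P * v Q) ^ 2 / (w P * w Q - 1#) ^ 2)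
  w∞-difference P Q wPwQ-1≉0 = w∞-⊕ (ι Q) (⊖ ι P) wPwQ-1≉0
    (solve 5 (λ a x₁ y₁ x₂ y₂ →
       (x₂ :* y₁ :+ :- x₁ :* y₂) :* (y₂ :* y₁ :- a :* x₂ :* (:- x₁))
       := x₂ :* y₂ :* (y₁ :* y₁ :- a :* (x₁ :* x₁)) :- x₁ :* y₁ :* (y₂ :* y₂ :- a :* (x₂ :* x₂)))
       refl a x₁ y₁ x₂ y₂)
    (solve 5 (λ d x₁ y₁ x₂ y₂ →
       let 1² = con (+ 1) :* con (+ 1)
           s  = d :* (x₂ :* y₂) :* (:- (x₁ :* y₁))
       in (1² :- s) :* (1² :+ s)
       := :- (d :* (x₁ :* x₁) :* (y₁ :* y₁) :* (d :* (x₂ :* x₂) :* (y₂ :* y₂)) :- con (+ 1)))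
       refl d x₁ y₁ x₂ y₂)
    where
    open AffinePoint P renaming (x to x₁; y to y₁)
    open AffinePoint Q renaming (x to x₂; y to y₂)

  module _ (P₁ P₂ : AffinePoint) (w₁w₂-1≉0 : w P₁ * w P₂ - 1# ≉ 0#) where

    private
      w₁ w₂ k α β n₃ n₀ : Carrier
      w₁ = w P₁
      w₂ = w P₂
      k  = w₁ * w₂ - 1#
      α  = t P₁ * v P₂
      β  = t P₂ * v P₁
      n₃ = d * (α + β) ^ 2
      n₀ = d * (β - α) ^ 2

      dα² : d * α ^ 2 ≈ w₁ * ((w₂ + 1#) ^ 2 - e * w₂)
      dα² = dt²v² P₁ P₂

      dβ² : d * β ^ 2 ≈ w₂ * ((w₁ + 1#) ^ 2 - e * w₁)
      dβ² = dt²v² P₂ P₁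

    -- `d² (α + β)² (β - α)² = (d α² - d β²)²`, which contains no odd power of `α` or `β`.
    w-sum*difference : n₃ / k ^ 2 * (n₀ / k ^ 2) ≈ (w₁ - w₂) ^ 2 / k ^ 2
    w-sum*difference = begin
      n₃ / k ^ 2 * (n₀ / k ^ 2)
        ≈⟨ solve 4 (λ d α β i →
             d :* ((α :+ β) :* (α :+ β)) :* i :* (d :* ((β :- α) :* (β :- α)) :* i)
             := (d :* (α :* α) :- d :* (β :* β)) :* (d :* (α :* α) :- d :* (β :* β)) :* (i :* i))
             refl d α β i ⟩
      (d * α ^ 2 - d * β ^ 2) ^ 2 * (i * i)
        ≈⟨ *-congʳ (*-cong dα²-dβ² dα²-dβ²) ⟩
      ((w₁ - w₂) * - k) ^ 2 * (i * i)
        ≈⟨ solve 3 (λ δ k i → (δ :* (:- k)) :* (δ :* (:- k)) :* (i :* i)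
                      := δ :* δ :* i :* (k :* k :* i)) refl (w₁ - w₂) k i ⟩
      (w₁ - w₂) ^ 2 * i * (k ^ 2 * i)
        -- The numerator contributes `k²`, which cancels one of the two denominators.
        ≈⟨ *-congˡ (⁻¹-inverseʳ (*-≉0 w₁w₂-1≉0 w₁w₂-1≉0)) ⟩
      (w₁ - w₂) ^ 2 * i * 1#
        ≈⟨ *-identityʳ _ ⟩
      (w₁ - w₂) ^ 2 / k ^ 2  ∎
      where
      i : Carrier
      i = (k ^ 2) ⁻¹
      dα²-dβ² : d * α ^ 2 - d * β ^ 2 ≈ (w₁ - w₂) * - k
      -- Both terms in `e` are `e w₁ w₂`, so `e` drops out of the difference.
      dα²-dβ² = trans (+-cong dα² (-‿cong dβ²))
        (solve 3 (λ e w₁ w₂ →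
           w₁ :* ((w₂ :+ con (+ 1)) :* (w₂ :+ con (+ 1)) :- e :* w₂)
             :- w₂ :* ((w₁ :+ con (+ 1)) :* (w₁ :+ con (+ 1)) :- e :* w₁)
           := (w₁ :- w₂) :* (:- (w₁ :* w₂ :- con (+ 1))))
           refl e w₁ w₂)

    -- The cross terms `2 d α β` cancel, leaving `2 (d α² + d β²)`.
    w-sum+difference : n₃ / k ^ 2 + n₀ / k ^ 2
      ≈ (2 · (w₁ + w₂) * (w₁ * w₂ + 1#) - 4 · (e - 2 · 1#) * w₁ * w₂) / k ^ 2
    w-sum+difference = trans (sym (distribʳ _ n₃ n₀)) (*-congʳ (begin
      d * (α + β) ^ 2 + d * (β - α) ^ 2
        ≈⟨ solve 3 (λ d α β → d :* ((α :+ β) :* (α :+ β)) :+ d :* ((β :- α) :* (β :- α))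
                      := con (+ 2) :* (d :* (α :* α) :+ d :* (β :* β))) refl d α β ⟩
      2 · 1# * (d * α ^ 2 + d * β ^ 2)
        ≈⟨ *-congˡ (+-cong dα² dβ²) ⟩
      2 · 1# * (w₁ * ((w₂ + 1#) ^ 2 - e * w₂) + w₂ * ((w₁ + 1#) ^ 2 - e * w₁))
        -- Each square `(w + 1)²` contributes `2 w₁ w₂`; with `- e w₁ w₂` this accounts for `e - 2`.
        ≈⟨ solve 3 (λ e w₁ w₂ →
             let e-2 = e :- con (+ 2)
             in con (+ 2) :* (w₁ :* ((w₂ :+ con (+ 1)) :* (w₂ :+ con (+ 1)) :- e :* w₂)
                  :+ w₂ :* ((w₁ :+ con (+ 1)) :* (w₁ :+ con (+ 1)) :- e :* w₁))
             := (w₁ :+ w₂ :+ (w₁ :+ w₂)) :* (w₁ :* w₂ :+ con (+ 1))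
                  :- (e-2 :+ e-2 :+ e-2 :+ e-2) :* w₁ :* w₂)
             refl e w₁ w₂ ⟩
      2 · (w₁ + w₂) * (w₁ * w₂ + 1#) - 4 · (e - 2 · 1#) * w₁ * w₂  ∎))

  -- For equal points the two summands coincide, and the square of their sum yields the factor 4.
  w-double : ∀ P → d * (t P * v P + t P * v P) ^ 2 ≈ 4 · w P * ((w P + 1#) ^ 2 - e * w P)
  w-double P = begin
    d * (α + α) ^ 2
      ≈⟨ solve 2 (λ d α → d :* ((α :+ α) :* (α :+ α)) := con (+ 4) :* (d :* (α :* α))) refl d α ⟩
    4 · 1# * (d * α ^ 2)
      ≈⟨ *-congˡ (dt²v² P P) ⟩
    4 · 1# * (w P * ((w P + 1#) ^ 2 - e * w P))
      ≈⟨ solve 2 (λ w f → con (+ 4) :* (w :* f) := (w :+ w :+ w :+ w) :* f)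
                 refl (w P) ((w P + 1#) ^ 2 - e * w P) ⟩
    4 · w P * ((w P + 1#) ^ 2 - e * w P)  ∎
    where
    α : Carrier
    α = t P * v P

proposition1 :
  ∀ {c ℓ} (F : FiniteField c ℓ) →
  let open FiniteField F in
  (odd : OddCharacteristic)
  (a d : Carrier) (ad[a-d]≉0 : a * d * (a - d) ≉ 0#) →
  let open TwistedEdwards F odd a d ad[a-d]≉0 in
  (P₁ P₂ : AffinePoint) →
  let w₁ = w P₁
      w₂ = w P₂
      e  = 4 · a / d
  in
  w₁ * w₂ ≉ 1# → w₁ ^ 2 ≉ 1# →
  ∃ λ w₀ → ∃ λ w₃ → ∃ λ w₄ →
    w∞ (ι P₂ ⊝ ι P₁) ≈∞ just w₀
    × w∞ (ι P₁ ⊕ ι P₂) ≈∞ just w₃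
    × w∞ (ι P₁ ⊕ ι P₁) ≈∞ just w₄
    × w₄ ≈ 4 · w₁ * ((w₁ + 1#) ^ 2 - e * w₁) / (w₁ ^ 2 - 1#) ^ 2
    × w₃ * w₀ ≈ (w₁ - w₂) ^ 2 / (w₁ * w₂ - 1#) ^ 2
    × w₃ + w₀ ≈ (2 · (w₁ + w₂) * (w₁ * w₂ + 1#) - 4 · (e - 2 · 1#) * w₁ * w₂) / (w₁ * w₂ - 1#) ^ 2
proposition1 F odd a d ad[a-d]≉0 P₁ P₂ w₁w₂≉1 w₁²≉1 =
  -- Unification reads `w₀`, `w₃`, `w₄` off the three finiteness proofs that follow.
  _ , _ , _
  , w∞-difference F odd a d ad[a-d]≉0 P₁ P₂ w₁w₂-1≉0
  , w∞-sum F odd a d ad[a-d]≉0 P₁ P₂ w₁w₂-1≉0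
  -- `w₁ ^ 2` unfolds to `w₁ * w₁`, so the second hypothesis is the nonvanishing needed for
  -- doubling.
  , w∞-sum F odd a d ad[a-d]≉0 P₁ P₁ (λ eq → w₁²≉1 (x-y≈0⇒x≈y eq))
  , *-congʳ (w-double F odd a d ad[a-d]≉0 P₁)
  , w-sum*difference F odd a d ad[a-d]≉0 P₁ P₂ w₁w₂-1≉0
  , w-sum+difference F odd a d ad[a-d]≉0 P₁ P₂ w₁w₂-1≉0
  where
  open FiniteField F
  open FieldProperties F
  open TwistedEdwards F odd a d ad[a-d]≉0
  w₁w₂-1≉0 : w P₁ * w P₂ - 1# ≉ 0#
  w₁w₂-1≉0 eq = w₁w₂≉1 (x-y≈0⇒x≈y eq)
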